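{- Let $k$ be a positive integer with $k \equiv 7 \pmod{15}$ and let \[ n = L_{CC}(10,k) = \frac{512k^5+1280k^4+6080k^3+7840k^2+10010k+3741}{3125}. \] Then there is an undirected Cayley graph of the cyclic group $\mathbb{Z}_n$ on five generators which has diameter $k$. Moreover, a generating set for such a graph is \[ \Big\{1,\ \tfrac{128k^4+256k^3+1192k^2+1064k+883}{625},\ \tfrac{512k^5+640k^4+3200k^3-2520k^2-8510k-12624}{9375},\ \tfrac{512k^5+640k^4+5600k^3+1080k^2+4540k-6699}{9375},\ \tfrac{512k^5+640k^4+5600k^3+1080k^2+12040k-2949}{9375}\Big\}, \] i.e. the Cayley graph of $\mathbb{Z}_n$ with connection set $\{\pm g_1,\dots,\pm g_5\}$, where $g_1,\dots,g_5$ are these integers taken modulo $n$, has diameter $k$.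
   Context: For a positive integer $n$ and integers $g_1,\dots,g_5$, the undirected Cayley (circulant) graph of the cyclic group $\mathbb{Z}_n$ with generating set $\{g_1,\dots,g_5\}$ has vertex set $\mathbb{Z}_n$, with $i$ and $j$ adjacent if and only if $j-i \equiv \pm g_t \pmod n$ for some $t$. Its diameter is the maximum over pairs of vertices of the graph distance. The notation $L_{CC}(10,k)$ is just a name for the displayed polynomial value. -}

module Defs where

open import Data.Nat as ℕ using (ℕ; zero; suc)
open import Data.Integer as ℤ using (ℤ; +_; _-_; -_)
open import Data.Integer.DivMod using (_/ℕ_)
open import Data.Integer.Divisibility using (_∣_)
open import Data.Fin as Fin using (Fin; toℕ)
open import Data.Product using (Σ; ∃; _×_)
open import Data.Sum using (_⊎_)
open import Relation.Binary.PropositionalEquality using (_≡_)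

_≡_[mod_] : ℤ → ℤ → ℕ → Set
a ≡ b [mod n ] = (+ n) ∣ (a - b)

vtx : {n : ℕ} → Fin n → ℤ
vtx i = + (toℕ i)

Adj : (n : ℕ) → (Fin 5 → ℤ) → Fin n → Fin n → Set
Adj n g i j = ∃ λ (t : Fin 5) →
  ((vtx j - vtx i) ≡ g t [mod n ]) ⊎ ((vtx j - vtx i) ≡ - g t [mod n ])

data Walk (n : ℕ) (g : Fin 5 → ℤ) : ℕ → Fin n → Fin n → Set where
  here : ∀ {i} → Walk n g zero i i
  step : ∀ {m i j l} → Adj n g i j → Walk n g m j l → Walk n g (suc m) i l

DistLe : (n : ℕ) → (Fin 5 → ℤ) → ℕ → Fin n → Fin n → Set
DistLe n g d i j = ∃ λ m → (m ℕ.≤ d) × Walk n g m i j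

HasDiameter : (n : ℕ) → (Fin 5 → ℤ) → ℕ → Set
HasDiameter n g d =
  ((i j : Fin n) → DistLe n g d i j) ×
  (∃ λ (i : Fin n) → ∃ λ (j : Fin n) → (d' : ℕ) → DistLe n g d' i j → d ℕ.≤ d')

numN : ℕ → ℤ
numN k = let x = + k in
  + 512 ℤ.* x ℤ.^ 5 ℤ.+ + 1280 ℤ.* x ℤ.^ 4 ℤ.+ + 6080 ℤ.* x ℤ.^ 3
  ℤ.+ + 7840 ℤ.* x ℤ.^ 2 ℤ.+ + 10010 ℤ.* x ℤ.+ + 3741

num2 : ℕ → ℤ
num2 k = let x = + k in
  + 128 ℤ.* x ℤ.^ 4 ℤ.+ + 256 ℤ.* x ℤ.^ 3 ℤ.+ + 1192 ℤ.* x ℤ.^ 2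
  ℤ.+ + 1064 ℤ.* x ℤ.+ + 883

num3 : ℕ → ℤ
num3 k = let x = + k in
  + 512 ℤ.* x ℤ.^ 5 ℤ.+ + 640 ℤ.* x ℤ.^ 4 ℤ.+ + 3200 ℤ.* x ℤ.^ 3
  - + 2520 ℤ.* x ℤ.^ 2 - + 8510 ℤ.* x - + 12624

num4 : ℕ → ℤ
num4 k = let x = + k in
  + 512 ℤ.* x ℤ.^ 5 ℤ.+ + 640 ℤ.* x ℤ.^ 4 ℤ.+ + 5600 ℤ.* x ℤ.^ 3
  ℤ.+ + 1080 ℤ.* x ℤ.^ 2 ℤ.+ + 4540 ℤ.* x - + 6699

num5 : ℕ → ℤ
num5 k = let x = + k in
  + 512 ℤ.* x ℤ.^ 5 ℤ.+ + 640 ℤ.* x ℤ.^ 4 ℤ.+ + 5600 ℤ.* x ℤ.^ 3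
  ℤ.+ + 1080 ℤ.* x ℤ.^ 2 ℤ.+ + 12040 ℤ.* x - + 2949

-- L_CC(10,k) : the numerator is a nonnegative integer, so ∣_∣ just drops the sign
LCC10 : ℕ → ℕ
LCC10 k = ℤ.∣ numN k ∣ ℕ./ 3125

gens : ℕ → Fin 5 → ℤ
gens k Fin.zero = + 1
gens k (Fin.suc Fin.zero) = num2 k /ℕ 625
gens k (Fin.suc (Fin.suc Fin.zero)) = num3 k /ℕ 9375
gens k (Fin.suc (Fin.suc (Fin.suc Fin.zero))) = num4 k /ℕ 9375
gens k (Fin.suc (Fin.suc (Fin.suc (Fin.suc Fin.zero)))) = num5 k /ℕ 9375

{-# OPTIONS --safe #-}

-- Write k = 15m + 7 and s = 6m + 3, so that 5s = 2k + 1.  The kernel of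
-- φ : ℤ⁵ → ℤₙ, x ↦ Σ xⱼgⱼ, is the lattice generated by uⱼ = 2s·eⱼ + Aⱼ
-- (j = 1, …, 5), where A is an antisymmetric matrix with entries 0, ±1, and by
-- w = ½ Σ uⱼ.  The diameter is the ℓ¹ covering radius of this lattice.
--
-- Upper bound.  For signs ε let w_ε = ½ Σ εⱼuⱼ; antisymmetry gives ‖w_ε‖ = 5s.
-- If x lies in the box spanned by 0 and w_ε, then ‖x − w_ε‖ = 5s − ‖x‖, which is
-- less than ‖x‖ as soon as ‖x‖ > k.  If x lies in none of these boxes, then some
-- Σ_{j ∈ T} sgn(xⱼ)uⱼ with T ⊆ supp x shortens x (T certifies that the zero
-- coordinates of x cannot be given signs that put x in a box).  This depends only
-- on the signs of the coordinates and on how ∣xⱼ∣ − s compares with a few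
-- constants, so it is decided by computation.
--
-- Lower bound.  Let p be a rounding of w/2.  A point of p + ker φ is
-- x = p − ½ Σ cⱼuⱼ with all cⱼ of the same parity.  With σⱼ the sign of 1 − 2cⱼ,
-- ‖x‖ ≥ Σ σⱼxⱼ; antisymmetry cancels most of the A-terms and leaves at least k.

module Submission where

open import Defs
open import Algebra.Properties.AbelianGroup using (∙-cancelʳ)
open import Data.Bool using (Bool; false; if_then_else_; T; _∧_; _∨_)
open import Data.Bool.ListAction using (all; any)
open import Data.Bool.Properties using (T-∧; T-∨)
open import Data.Empty using (⊥-elim)
open import Data.Fin as Fin using (Fin; fromℕ<; toℕ; #_)
open import Data.Fin.Properties using (toℕ-fromℕ<; toℕ-injective; toℕ<n)
open import Data.Integer as ℤ hiding (suc; _%_; _<_)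
open import Data.Integer.Divisibility using (_∣_)
open import Data.Integer.Divisibility.Signed using (divides; ∣ᵤ⇒∣; ∣⇒∣ᵤ; ∣m∣n⇒∣m+n; ∣m⇒∣-m) renaming (_∣_ to _∣ₛ_)
open import Data.Integer.DivMod using (a≡a%ℕn+[a/ℕn]*n; n%ℕd<d)
open import Data.Integer.Properties
open import Data.Integer.Tactic.RingSolver using (solve-∀)
open import Data.List as List using (List; []; _∷_; _++_)
open import Data.List.Relation.Unary.Any using (satisfied)
open import Data.List.Relation.Unary.Any.Properties using (any⁻)
open import Data.Maybe as Maybe using (Maybe; just; nothing)
open import Data.Maybe.Relation.Unary.All using (All; just; nothing)
open import Data.Nat as ℕ using (ℕ; zero; suc; _<_; _%_)
import Data.Nat.Divisibility as ℕ
import Data.Nat.DivMod as ℕ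
open import Data.Nat.Induction using (<-wellFounded)
import Data.Nat.Properties as ℕ
open import Data.Product using (∃; _×_; _,_; proj₁; proj₂)
open import Data.Sign as Sign using (Sign)
open import Data.Sum using (_⊎_; inj₁; inj₂)
open import Data.Vec as Vec using (Vec; []; _∷_)
open import Data.Vec.Relation.Binary.Pointwise.Inductive using (Pointwise; []; _∷_)
open import Function using (Equivalence; _∘_; id)
open import Induction.WellFounded using (Acc; acc)
open import Relation.Binary.PropositionalEquality using (_≡_; _≢_; cong; cong₂; refl; subst; subst₂; sym; trans)
open import Relation.Nullary.Decidable using (no; toWitness; yes; ⌊_⌋)

-- Integer inequalities, signs and the ℓ¹ norm

open ≤-Reasoning

-- Reduces an inequality to one already known and a ring identity, which `solve-∀` can settle.
≤-via : ∀ {a b c d} → c ≤ d → d - c ≡ b - a → a ≤ b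
≤-via c≤d eq = 0≤i-j⇒j≤i (subst (0ℤ ≤_) eq (i≤j⇒0≤j-i c≤d))

abs-≤ : ∀ {i j} → i ≤ j → - i ≤ j → + ∣ i ∣ ≤ j
abs-≤ {+ _}       p _ = p
abs-≤ { -[1+ _ ]} _ q = q

i≤+∣i∣ : ∀ i → i ≤ + ∣ i ∣
i≤+∣i∣ (+ _)    = ≤-refl
i≤+∣i∣ -[1+ _ ] = -≤+

infixr 8 _•_
_•_ : Sign → ℤ → ℤ
Sign.+ • x = x
Sign.- • x = - x

∣•∣ : ∀ ε i → ∣ ε • i ∣ ≡ ∣ i ∣
∣•∣ Sign.+ i = refl
∣•∣ Sign.- i = ∣-i∣≡∣i∣ i

•≡∣∣ : ∀ ε {x} → 1ℤ ≤ ε • x → ε • x ≡ + ∣ x ∣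
•≡∣∣ ε {x} 1≤y = trans (sym (0≤i⇒+∣i∣≡i (≤-trans (+≤+ ℕ.z≤n) 1≤y))) (cong +_ (∣•∣ ε x))

•-suc : ∀ ε c h → ε • (1ℤ + c) * h ≡ ε • h + ε • c * h
•-suc Sign.+ = e
  where
  e : ∀ c h → (1ℤ + c) * h ≡ h + c * h
  e = solve-∀
•-suc Sign.- = e
  where
  e : ∀ c h → - (1ℤ + c) * h ≡ - h + - c * h
  e = solve-∀

norm : ∀ {r} → Vec ℤ r → ℕ
norm []       = 0
norm (x ∷ xs) = ∣ x ∣ ℕ.+ norm xs

infixl 6 _⊖ᵥ_
_⊖ᵥ_ : ∀ {r} → Vec ℤ r → Vec ℤ r → Vec ℤ r
_⊖ᵥ_ = Vec.zipWith _-_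

-- The lattice

-- (α , β) stands for α s + β.
Form : Set
Form = ℤ × ℤ

eval : ℤ → Form → ℤ
eval s (α , β) = α * s + β

•-eval : ∀ ε s α β x → ε • (x - eval s (α , β)) ≡ ε • x - (ε • α * s + ε • β)
•-eval Sign.+ s α β x = refl
•-eval Sign.- = e
  where
  e : ∀ s α β x → - (x - (α * s + β)) ≡ - x - (- α * s + - β)
  e = solve-∀

Coeffs : Set
Coeffs = ℤ × Vec ℤ 5

A : Vec (Vec ℤ 5) 5
A = (0ℤ  ∷ 0ℤ  ∷ 0ℤ  ∷ 1ℤ ∷ -1ℤ ∷ [])
  ∷ (0ℤ  ∷ 0ℤ  ∷ -1ℤ ∷ 1ℤ ∷ 0ℤ  ∷ [])
  ∷ (0ℤ  ∷ 1ℤ  ∷ 0ℤ  ∷ 1ℤ ∷ 0ℤ  ∷ [])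
  ∷ (-1ℤ ∷ -1ℤ ∷ -1ℤ ∷ 0ℤ ∷ -1ℤ ∷ [])
  ∷ (1ℤ  ∷ 0ℤ  ∷ 0ℤ  ∷ 1ℤ ∷ 0ℤ  ∷ [])
  ∷ []

-- The coordinates of b w + Σ aⱼuⱼ, where w = (s , s , s − 1 , s + 2 , s − 1).
forms : Coeffs → Vec Form 5
forms (b , a₁ ∷ a₂ ∷ a₃ ∷ a₄ ∷ a₅ ∷ []) =
    (b + + 2 * a₁ , - a₄ + a₅)
  ∷ (b + + 2 * a₂ , a₃ - a₄)
  ∷ (b + + 2 * a₃ , - a₂ - a₄ - b)
  ∷ (b + + 2 * a₄ , a₁ + a₂ + a₃ + a₅ + + 2 * b)
  ∷ (b + + 2 * a₅ , - a₁ - a₄ - b)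
  ∷ []

lattice : ℤ → Coeffs → Vec ℤ 5
lattice s c = Vec.map (eval s) (forms c)

-- Shortening long vectors

-- What is known about a coordinate x: either x = 0, or its sign ε and possibly
-- offsets d with s + d ≤ ∣x∣ (first) and with ∣x∣ ≤ s + d (second).
data Range : Set where
  null   : Range
  signed : Sign → Maybe ℤ → Maybe ℤ → Range

-- An upper bound for ∣x − l∣ − ∣x∣, valid when s ≥ 3 (whence the − 6 = − 2·3).
change : Range → Form → Maybe ℤ
change null (+ 0 , β) = just (+ ∣ β ∣)
change (signed ε lo _) (α , β) with ε • α | lo
... | + 0 | _      = just (- (ε • β) ⊔ (ε • β - + 2))
... | + 2 | just d = just ((ε • β - + 2 * d) ⊔ (- + 6 - ε • β))
... | _   | _      = nothing
change _ _ = nothing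

-- An upper bound for ∣x − l∣ + ∣x∣ − s, defined when x lies between 0 and l = ± s + β.
reflect : Range → Form → Maybe ℤ
reflect null (+ 1      , β) = if ⌊ - + 3 ≤? β ⌋ then just β else nothing
reflect null (-[1+ 0 ] , β) = if ⌊ - + 3 ≤? - β ⌋ then just (- β) else nothing
reflect (signed ε _ (just d)) (α , β) with ε • α
... | + 1 = if ⌊ d ≤? ε • β ⌋ then just (ε • β) else nothing
... | _   = nothing
reflect _ _ = nothing

total : ∀ {r} → (Range → Form → Maybe ℤ) → Vec Range r → Vec Form r → Maybe ℤ
total f []       []       = just 0ℤ
total f (i ∷ is) (l ∷ ls) = Maybe.zipWith _+_ (f i l) (total f is ls)

shortens : Vec Range 5 → Coeffs → Bool
shortens is c = Maybe.maybe (λ z → ⌊ z <? 0ℤ ⌋) false (total change is (forms c))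
              ∨ Maybe.maybe (λ z → ⌊ z ≤? 0ℤ ⌋) false (total reflect is (forms c))

-- The sums Σ_{j ∈ T} εⱼuⱼ, with T consisting of coordinates bounded from below.
shifts : ∀ {r} → Vec Range r → List (Vec ℤ r)
shifts []                          = [] ∷ []
shifts (signed ε (just _) _ ∷ is) = List.map (ε • 1ℤ ∷_) (shifts is) ++ List.map (0ℤ ∷_) (shifts is)
shifts (_ ∷ is)                    = List.map (0ℤ ∷_) (shifts is)

-- The vectors w_ε = w − Σ_{εⱼ = −} uⱼ, with the signs at null coordinates free.
corners : ∀ {r} → Vec Range r → List (Vec ℤ r)
corners []                               = [] ∷ []
corners (null ∷ is)                      = List.map (0ℤ ∷_) (corners is) ++ List.map (-1ℤ ∷_) (corners is)
corners (signed Sign.+ _ (just _) ∷ is) = List.map (0ℤ ∷_) (corners is)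
corners (signed Sign.- _ (just _) ∷ is) = List.map (-1ℤ ∷_) (corners is)
corners (_ ∷ is)                         = []

candidates : Vec Range 5 → List Coeffs
candidates is = List.map (0ℤ ,_) (shifts is) ++ List.map (1ℤ ,_) (corners is)

closes : Vec Range 5 → Bool
closes is = any (shortens is) (candidates is)

-- For integers, s + d < ∣x∣ is the same as s + (1 + d) ≤ ∣x∣, hence the shifted offset in `above`.
above below : ℤ → Range → Range
above d null             = null
above d (signed ε lo hi) = signed ε (just (1ℤ + d)) hi
below d null             = null
below d (signed ε lo hi) = signed ε lo (just d)

-- split j d asks whether ∣xⱼ∣ > s + d.
data Plan : Set where
  done  : Plan
  split : Fin 5 → ℤ → Plan → Plan → Plan

solve : Plan → Vec Range 5 → Bool
solve done            is = closes is
solve (split j d p q) is = closes is ∨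
  (solve p (Vec.updateAt is j (above d)) ∧ solve q (Vec.updateAt is j (below d)))

-- The j-th coordinate of w_ε is, up to sign, s + d with 2d = − Σᵢ εⱼεᵢAⱼᵢ.  The
-- thresholds for ∣xⱼ∣ are all the values of this d for the signs that are left
-- free at the null coordinates, in decreasing order.
splits : Vec Range 5 → Fin 5 → Plan → Plan
splits is j rest with Vec.lookup is j
... | null         = rest
... | signed ε _ _ = descend free (half (+ free - ε • fixed))
  where
  sgn : Range → ℤ
  sgn null           = 0ℤ
  sgn (signed ε _ _) = ε • 1ℤ

  weight : ℤ → Range → ℕ
  weight a null           = ∣ a ∣
  weight a (signed _ _ _) = 0

  fixed : ℤ
  fixed = Vec.foldr _ _+_ 0ℤ (Vec.zipWith (λ a i → a * sgn i) (Vec.lookup A j) is)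

  free : ℕ
  free = Vec.sum (Vec.zipWith weight (Vec.lookup A j) is)

  -- Every row of `A` has an even number of nonzero entries, so `free` and `fixed` have the same
  -- parity and the division by 2 is exact.
  half : ℤ → ℤ
  half (+ n)    = + (n ℕ./ 2)
  half -[1+ n ] = - + (suc n ℕ./ 2)

  descend : ℕ → ℤ → Plan
  descend zero    d = split j d rest rest
  descend (suc n) d = split j d rest (descend n (d - 1ℤ))

plan : Vec Range 5 → Plan
plan is = List.foldr (splits is) done (List.allFin 5)

solvable : Vec Range 5 → Bool
solvable is = solve (plan is) is

signRange : ℤ → Range
signRange (+ 0)    = null
signRange +[1+ _ ] = signed Sign.+ nothing nothing
signRange -[1+ _ ] = signed Sign.- nothing nothing

allSigns : ∀ r → (Vec Range r → Bool) → Bool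
allSigns zero    f = f []
allSigns (suc r) f = allSigns r (f ∘ (null ∷_))
  ∧ allSigns r (f ∘ (signed Sign.+ nothing nothing ∷_))
  ∧ allSigns r (f ∘ (signed Sign.- nothing nothing ∷_))

allSigns-sound : ∀ {r} (f : Vec Range r → Bool) → T (allSigns r f) → ∀ xs → T (f (Vec.map signRange xs))
allSigns-sound f t []              = t
allSigns-sound f t (+ 0      ∷ xs) = allSigns-sound (f ∘ (null ∷_)) (proj₁ (Equivalence.to T-∧ t)) xs
allSigns-sound {suc r} f t (+[1+ _ ] ∷ xs) = allSigns-sound (f ∘ (signed Sign.+ nothing nothing ∷_))
  (proj₁ (Equivalence.to T-∧ (proj₂ (Equivalence.to (T-∧ {allSigns r (f ∘ (null ∷_))}) t)))) xs
allSigns-sound {suc r} f t (-[1+ _ ] ∷ xs) = allSigns-sound (f ∘ (signed Sign.- nothing nothing ∷_))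
  (proj₂ (Equivalence.to (T-∧ {allSigns r (f ∘ (signed Sign.+ nothing nothing ∷_))})
    (proj₂ (Equivalence.to (T-∧ {allSigns r (f ∘ (null ∷_))}) t)))) xs

-- Soundness of the search

All-zipWith : ∀ {Q R S : ℤ → Set} → (∀ {a b} → Q a → R b → S (a + b)) →
  ∀ {p q} → All Q p → All R q → All S (Maybe.zipWith _+_ p q)
All-zipWith f (just p) (just q) = just (f p q)
All-zipWith f (just p) nothing  = nothing
All-zipWith f nothing  (just q) = nothing
All-zipWith f nothing  nothing  = nothing

T-maybe : ∀ {Q : ℤ → Set} {R : Set} {f : ℤ → Bool} → (∀ {c} → Q c → T (f c) → R) →
  ∀ {m} → All Q m → T (Maybe.maybe f false m) → R
T-maybe h (just p) t = h p t

module _ (s : ℤ) where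

  data Sat : Range → ℤ → Set where
    null   : Sat null 0ℤ
    signed : ∀ {ε x lo hi} → 1ℤ ≤ ε • x → All (λ d → s + d ≤ ε • x) lo →
             All (λ d → ε • x ≤ s + d) hi → Sat (signed ε lo hi) x

  ChangeBound ReflectBound : ∀ {n} → Vec ℤ n → Vec Form n → ℤ → Set
  ChangeBound xs ls c = + norm (xs ⊖ᵥ Vec.map (eval s) ls) ≤ + norm xs + c
  ReflectBound {n} xs ls c = + norm (xs ⊖ᵥ Vec.map (eval s) ls) + + norm xs ≤ + n * s + c

  module _ (3≤s : + 3 ≤ s) where

    change-sound : ∀ {i x} → Sat i x → ∀ l →
      All (λ c → + ∣ x - eval s l ∣ ≤ + ∣ x ∣ + c) (change i l)
    change-sound null (+ 0 , β) = just (≤-reflexive (cong +_ (trans (cong ∣_∣ eq) (∣-i∣≡∣i∣ β))))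
      where
      eq : 0ℤ - (0ℤ * s + β) ≡ - β
      eq = trans (+-identityˡ _) (cong -_ (trans (cong (_+ β) (*-zeroˡ s)) (+-identityˡ β)))
    change-sound null (+[1+ _ ] , β) = nothing
    change-sound null (-[1+ _ ] , β) = nothing
    change-sound {x = x} (signed {ε} {lo = lo} 1≤y lo≤ hi≥) (α , β) with ε • α | lo | lo≤ | •-eval ε s α β x
    -- ∣y - b∣ - y is either -b, or b - 2y, which is at most b - 2 because y ≥ 1.
    ... | + 0 | _ | _ | eq = just (subst₂ (λ p q → + p ≤ q + c)
        (trans (sym (cong ∣_∣ eq)) (∣•∣ ε _)) (•≡∣∣ ε 1≤y)
        (abs-≤ (≤-via (i≤i⊔j (- b) (b - + 2)) (e₁ y b c s))
               (≤-via (+-mono-≤ (i≤j⊔i (- b) (b - + 2)) (+-mono-≤ 1≤y 1≤y)) (e₂ y b c s))))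
      where
      y = ε • x
      b = ε • β
      c = - b ⊔ (b - + 2)
      e₁ : ∀ y b c s → c - - b ≡ y + c - (y - (0ℤ * s + b))
      e₁ = solve-∀
      e₂ : ∀ y b c s → c + (y + y) - (b - + 2 + (1ℤ + 1ℤ)) ≡ y + c - - (y - (0ℤ * s + b))
      e₂ = solve-∀
    -- ∣y - 2s - b∣ - y is either b + 2s - 2y ≤ b - 2d, because y ≥ s + d, or -2s - b ≤ -6 - b,
    -- because s ≥ 3.
    ... | + 2 | just d | just d≤ | eq = just (subst₂ (λ p q → + p ≤ q + c)
        (trans (sym (cong ∣_∣ eq)) (∣•∣ ε _)) (•≡∣∣ ε 1≤y)
        (abs-≤ (≤-via (+-mono-≤ (i≤j⊔i (b - + 2 * d) (- + 6 - b)) (+-mono-≤ 3≤s 3≤s)) (e₁ y b c s))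
               (≤-via (+-mono-≤ (i≤i⊔j (b - + 2 * d) (- + 6 - b)) (+-mono-≤ d≤ d≤)) (e₂ y b c s d))))
      where
      y = ε • x
      b = ε • β
      c = (b - + 2 * d) ⊔ (- + 6 - b)
      e₁ : ∀ y b c s → c + (s + s) - (- + 6 - b + (+ 3 + + 3)) ≡ y + c - (y - (+ 2 * s + b))
      e₁ = solve-∀
      e₂ : ∀ y b c s d → c + (y + y) - (b - + 2 * d + (s + d + (s + d))) ≡ y + c - - (y - (+ 2 * s + b))
      e₂ = solve-∀
    ... | + 1 | _ | _ | _ = nothing
    ... | + 2 | nothing | _ | _ = nothing
    ... | +[1+ suc (suc _) ] | _ | _ | _ = nothing
    ... | -[1+ _ ] | _ | _ | _ = nothing

    reflect-sound : ∀ {i x} → Sat i x → ∀ l →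
      All (λ c → + ∣ x - eval s l ∣ + + ∣ x ∣ ≤ s + c) (reflect i l)
    reflect-sound null (+ 1 , β) with - + 3 ≤? β
    ... | no  _ = nothing
    -- The test β ≥ -3 and s ≥ 3 give s + β ≥ 0, so ∣0 - (s + β)∣ is s + β.
    ... | yes p = just (subst (_≤ s + β) (sym (+-identityʳ _)) (abs-≤
        (≤-via (+-mono-≤ (+-mono-≤ p p) (+-mono-≤ 3≤s 3≤s)) (e₁ β s)) (≤-reflexive (e₂ β s))))
      where
      e₁ : ∀ β s → β + β + (s + s) - (- + 3 + - + 3 + (+ 3 + + 3)) ≡ s + β - (0ℤ - (1ℤ * s + β))
      e₁ = solve-∀
      e₂ : ∀ β s → - (0ℤ - (1ℤ * s + β)) ≡ s + β
      e₂ = solve-∀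
    reflect-sound null (-[1+ 0 ] , β) with - + 3 ≤? - β
    ... | no  _ = nothing
    ... | yes p = just (subst (_≤ s + - β) (sym (+-identityʳ _)) (abs-≤
        (≤-reflexive (e₂ β s)) (≤-via (+-mono-≤ (+-mono-≤ p p) (+-mono-≤ 3≤s 3≤s)) (e₁ β s))))
      where
      e₁ : ∀ β s → - β + - β + (s + s) - (- + 3 + - + 3 + (+ 3 + + 3)) ≡ s + - β - - (0ℤ - (-1ℤ * s + β))
      e₁ = solve-∀
      e₂ : ∀ β s → 0ℤ - (-1ℤ * s + β) ≡ s + - β
      e₂ = solve-∀
    reflect-sound null (+ 0 , β) = nothing
    reflect-sound null (+[1+ suc _ ] , β) = nothing
    reflect-sound null (-[1+ suc _ ] , β) = nothing
    reflect-sound (signed {hi = nothing} _ _ _) l = nothing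
    reflect-sound {x = x} (signed {ε} {hi = just d} 1≤y _ (just ≤d)) (α , β) with ε • α | •-eval ε s α β x
    ... | + 0 | _ = nothing
    ... | +[1+ suc _ ] | _ = nothing
    ... | -[1+ _ ] | _ = nothing
    ... | + 1 | eq with d ≤? ε • β
    ...   | no  _ = nothing
    -- Since y ≤ s + d ≤ s + b, the distance from y to s + b is s + b - y.
    ...   | yes p = just (subst₂ (λ p q → + p + q ≤ s + b)
        (trans (sym (cong ∣_∣ eq)) (∣•∣ ε _)) (•≡∣∣ ε 1≤y)
        (≤-via (abs-≤ {y - (1ℤ * s + b)} {s + b - y} (≤-via (+-mono-≤ (+-mono-≤ p p) (+-mono-≤ ≤d ≤d)) (e₁ y b s d))
               (≤-reflexive (e₂ y b s))) (e₃ y b s (+ ∣ y - (1ℤ * s + b) ∣))))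
      where
      y = ε • x
      b = ε • β
      e₁ : ∀ y b s d → b + b + (s + d + (s + d)) - (d + d + (y + y)) ≡ s + b - y - (y - (1ℤ * s + b))
      e₁ = solve-∀
      e₂ : ∀ y b s → - (y - (1ℤ * s + b)) ≡ s + b - y
      e₂ = solve-∀
      e₃ : ∀ y b s t → s + b - y - t ≡ s + b - (t + y)
      e₃ = solve-∀

    total-change : ∀ {n} {is : Vec Range n} {xs : Vec ℤ n} → Pointwise Sat is xs → ∀ ls →
      All (ChangeBound xs ls) (total change is ls)
    total-change [] [] = just ≤-refl
    total-change {xs = x ∷ xs} (p ∷ ps) (l ∷ ls) = All-zipWith
      (λ {a} {b} p q → ≤-via (+-mono-≤ p q)
        (e (+ ∣ x - eval s l ∣) (+ norm (xs ⊖ᵥ Vec.map (eval s) ls)) (+ ∣ x ∣) (+ norm xs) a b))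
      (change-sound p l) (total-change ps ls)
      where
      e : ∀ u v x y a b → x + a + (y + b) - (u + v) ≡ x + y + (a + b) - (u + v)
      e = solve-∀

    total-reflect : ∀ {n} {is : Vec Range n} {xs : Vec ℤ n} → Pointwise Sat is xs → ∀ ls →
      All (ReflectBound xs ls) (total reflect is ls)
    total-reflect [] [] = just (≤-reflexive (sym (cong (_+ 0ℤ) (*-zeroˡ s))))
    total-reflect {suc n} {xs = x ∷ xs} (p ∷ ps) (l ∷ ls) = All-zipWith
      (λ {a} {b} p q → ≤-via (+-mono-≤ p q)
        (e (+ ∣ x - eval s l ∣) (+ norm (xs ⊖ᵥ Vec.map (eval s) ls)) (+ ∣ x ∣) (+ norm xs) a b s (+ n)))
      (reflect-sound p l) (total-reflect ps ls)
      where
      e : ∀ u v x y a b s n → s + a + (n * s + b) - (u + x + (v + y)) ≡ (1ℤ + n) * s + (a + b) - (u + v + (x + y))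
      e = solve-∀

    module _ {x : Vec ℤ 5} (long : + 5 * s ℤ.< + norm x + + norm x) where

      Shortened : Set
      Shortened = ∃ λ c → norm (x ⊖ᵥ lattice s c) ℕ.< norm x

      -- Under the first criterion the norm changes by a negative amount. Under the second, ‖x - l‖
      -- + ‖x‖ ≤ 5s, and 5s < 2‖x‖ by `long`.
      shortens-sound : ∀ {is} → Pointwise Sat is x → ∀ c → T (shortens is c) → norm (x ⊖ᵥ lattice s c) ℕ.< norm x
      shortens-sound ps c t with Equivalence.to T-∨ t
      ... | inj₁ t = T-maybe (λ {d} p t → drop‿+<+ (≤-<-trans p
          (subst (+ norm x + d ℤ.<_) (+-identityʳ (+ norm x)) (+-monoʳ-< (+ norm x) (toWitness t)))))
        (total-change ps (forms c)) t
      ... | inj₂ t = T-maybe (λ p t → ℕ.+-cancelʳ-< (norm x) _ _ (drop‿+<+ (≤-<-trans p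
          (≤-<-trans (+-monoʳ-≤ (+ 5 * s) (toWitness t))
          (subst (ℤ._< + norm x + + norm x) (sym (+-identityʳ (+ 5 * s))) long)))))
        (total-reflect ps (forms c)) t

      closes-sound : ∀ {is} → Pointwise Sat is x → T (closes is) → Shortened
      closes-sound {is} ps t with satisfied (any⁻ (shortens is) (candidates is) t)
      ... | c , t = c , shortens-sound ps c t

      split-sound : ∀ {n} (i : Fin n) d {is} {x : Vec ℤ n} → Pointwise Sat is x →
        Pointwise Sat (Vec.updateAt is i (above d)) x ⊎ Pointwise Sat (Vec.updateAt is i (below d)) x
      split-sound Fin.zero d (null ∷ ps) = inj₁ (null ∷ ps)
      split-sound Fin.zero d {x = x ∷ _} (signed {ε} 1≤y lo hi ∷ ps) with ε • x ≤? s + d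
      ... | yes p = inj₂ (signed 1≤y lo (just p) ∷ ps)
      ... | no ¬p = inj₁ (signed 1≤y (just (subst (_≤ _) (e s d) (i<j⇒suc[i]≤j (≰⇒> ¬p)))) hi ∷ ps)
        where
        e : ∀ s d → 1ℤ + (s + d) ≡ s + (1ℤ + d)
        e = solve-∀
      split-sound (Fin.suc i) d (p ∷ ps) with split-sound i d ps
      ... | inj₁ ps = inj₁ (p ∷ ps)
      ... | inj₂ ps = inj₂ (p ∷ ps)

      -- Sound for an arbitrary plan: the choice of thresholds in `plan` only decides whether the
      -- check succeeds.
      solve-sound : ∀ p {is} → Pointwise Sat is x → T (solve p is) → Shortened
      solve-sound done ps t = closes-sound ps t
      solve-sound (split i d p q) ps t with Equivalence.to T-∨ t
      ... | inj₁ t = closes-sound ps t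
      ... | inj₂ t with Equivalence.to T-∧ t | split-sound i d ps
      ...   | t , _ | inj₁ ps = solve-sound p ps t
      ...   | _ , t | inj₂ ps = solve-sound q ps t

    signRange-sat : ∀ {n} (xs : Vec ℤ n) → Pointwise Sat (Vec.map signRange xs) xs
    signRange-sat []              = []
    signRange-sat (+ 0      ∷ xs) = null ∷ signRange-sat xs
    signRange-sat (+[1+ _ ] ∷ xs) = signed (+≤+ (ℕ.s≤s ℕ.z≤n)) nothing nothing ∷ signRange-sat xs
    signRange-sat (-[1+ _ ] ∷ xs) = signed (+≤+ (ℕ.s≤s ℕ.z≤n)) nothing nothing ∷ signRange-sat xs

    shorten : ∀ x → + 5 * s ℤ.< + norm x + + norm x → ∃ λ c → norm (x ⊖ᵥ lattice s c) ℕ.< norm x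
    -- The underscore stands for the whole case analysis: `T (allSigns 5 solvable)` is evaluated
    -- over the 3⁵ sign patterns and reduces to the unit type.
    shorten x long = solve-sound long (plan is) (signRange-sat x) (allSigns-sound solvable _ x)
      where is = Vec.map signRange x

    -- Well-founded descent on the norm. `Q` is any property invariant under subtracting lattice
    -- vectors, later that of representing a given displacement.
    reduce : (Q : Vec ℤ 5 → Set) → (∀ x c → Q x → Q (x ⊖ᵥ lattice s c)) →
      ∀ x → Q x → ∃ λ x′ → Q x′ × + norm x′ + + norm x′ ≤ + 5 * s
    reduce Q closed x = go x (<-wellFounded (norm x))
      where
      go : ∀ x → Acc ℕ._<_ (norm x) → Q x → ∃ λ x′ → Q x′ × + norm x′ + + norm x′ ≤ + 5 * s
      go x (acc rs) q with + norm x + + norm x ≤? + 5 * s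
      ... | yes p = x , q , p
      ... | no ¬p with shorten x (≰⇒> ¬p)
      ...   | c , lt = go (x ⊖ᵥ lattice s c) (rs lt) (closed x c q)

-- Walks and displacements

φ : ∀ {r} → (Fin r → ℤ) → Vec ℤ r → ℤ
φ g []       = 0ℤ
φ g (x ∷ xs) = x * g Fin.zero + φ (g ∘ Fin.suc) xs

φ-cong : ∀ {r} {g h : Fin r → ℤ} → (∀ t → g t ≡ h t) → ∀ x → φ g x ≡ φ h x
φ-cong eq []       = refl
φ-cong eq (x ∷ xs) = cong₂ _+_ (cong (x *_) (eq Fin.zero)) (φ-cong (eq ∘ Fin.suc) xs)

φ-zeros : ∀ {r} (g : Fin r → ℤ) → φ g (Vec.replicate r 0ℤ) ≡ 0ℤ
φ-zeros {zero}  g = refl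
φ-zeros {suc r} g = cong₂ _+_ (*-zeroˡ (g Fin.zero)) (φ-zeros (g ∘ Fin.suc))

φ-⊖ᵥ : ∀ {r} (g : Fin r → ℤ) xs ys → φ g (xs ⊖ᵥ ys) ≡ φ g xs - φ g ys
φ-⊖ᵥ g []       []       = refl
φ-⊖ᵥ g (x ∷ xs) (y ∷ ys) = trans (cong (_+_ ((x - y) * g Fin.zero)) (φ-⊖ᵥ (g ∘ Fin.suc) xs ys))
  (e x y (g Fin.zero) (φ (g ∘ Fin.suc) xs) (φ (g ∘ Fin.suc) ys))
  where
  e : ∀ x y g a b → (x - y) * g + (a - b) ≡ x * g + a - (y * g + b)
  e = solve-∀

φ-updateAt : ∀ {r} (g : Fin r → ℤ) xs t ε → φ g (Vec.updateAt xs t (_+_ ε)) ≡ ε * g t + φ g xs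
φ-updateAt g (x ∷ xs) Fin.zero ε = e ε x (g Fin.zero) (φ (g ∘ Fin.suc) xs)
  where
  e : ∀ ε x g a → (ε + x) * g + a ≡ ε * g + (x * g + a)
  e = solve-∀
φ-updateAt g (x ∷ xs) (Fin.suc t) ε =
  trans (cong (_+_ (x * g Fin.zero)) (φ-updateAt (g ∘ Fin.suc) xs t ε))
    (e (ε * g (Fin.suc t)) (x * g Fin.zero) (φ (g ∘ Fin.suc) xs))
  where
  e : ∀ u v a → v + (u + a) ≡ u + (v + a)
  e = solve-∀

norm-updateAt : ∀ {r} (xs : Vec ℤ r) t ε → norm (Vec.updateAt xs t (_+_ ε)) ℕ.≤ ∣ ε ∣ ℕ.+ norm xs
norm-updateAt (x ∷ xs) Fin.zero ε = ℕ.≤-trans (ℕ.+-monoˡ-≤ (norm xs) (∣i+j∣≤∣i∣+∣j∣ ε x))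
  (ℕ.≤-reflexive (ℕ.+-assoc ∣ ε ∣ ∣ x ∣ (norm xs)))
norm-updateAt (x ∷ xs) (Fin.suc t) ε = ℕ.≤-trans (ℕ.+-monoʳ-≤ ∣ x ∣ (norm-updateAt xs t ε))
  (ℕ.≤-reflexive (trans (sym (ℕ.+-assoc ∣ x ∣ ∣ ε ∣ (norm xs)))
    (trans (cong (ℕ._+ norm xs) (ℕ.+-comm ∣ x ∣ ∣ ε ∣)) (ℕ.+-assoc ∣ ε ∣ ∣ x ∣ (norm xs)))))

norm-⊖ᵥ-⊖ᵥ : ∀ {r} (x y : Vec ℤ r) → norm (x ⊖ᵥ (x ⊖ᵥ y)) ≡ norm y
norm-⊖ᵥ-⊖ᵥ []      []      = refl
norm-⊖ᵥ-⊖ᵥ (x ∷ u) (y ∷ v) = cong₂ ℕ._+_ (cong ∣_∣ (e x y)) (norm-⊖ᵥ-⊖ᵥ u v)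
  where
  e : ∀ x y → x - (x - y) ≡ y
  e = solve-∀

-- A record lets `a` and `b` be inferred from the type, which their difference alone would not
-- allow. Signed divisibility keeps the quotient available.
record Cong (n : ℕ) (a b : ℤ) : Set where
  constructor by
  field difference : + n ∣ₛ a - b
open Cong

Cong-via : ∀ {n a b d} → + n ∣ₛ d → d ≡ a - b → Cong n a b
Cong-via {n} p eq = by (subst (+ n ∣ₛ_) eq p)

-- Labels lie between 0 and n - 1, so their difference is smaller than n in absolute value, and the
-- only such multiple of n is 0.
vtx-injective : ∀ {n} {i j : Fin n} → Cong n (vtx j) (vtx i) → i ≡ j
vtx-injective {n} {i} {j} p =
  toℕ-injective (sym (+-injective (i-j≡0⇒i≡j _ _ (∣i∣≡0⇒i≡0 (small _ lt (∣⇒∣ᵤ (difference p)))))))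
  where
  small : ∀ d → d ℕ.< n → n ℕ.∣ d → d ≡ 0
  small zero    _  _   = refl
  small (suc d) lt n∣d = ⊥-elim (ℕ.<⇒≱ lt (ℕ.∣⇒≤ n∣d))

  lt : ∣ vtx j - vtx i ∣ ℕ.< n
  lt = ℕ.≤-<-trans (ℕ.≤-reflexive (cong ∣_∣ (m-n≡m⊖n (toℕ j) (toℕ i))))
         (ℕ.≤-<-trans (∣m⊝n∣≤m⊔n (toℕ j) (toℕ i)) (ℕ.⊔-pres-<m (toℕ<n j) (toℕ<n i)))

vert : ∀ n .{{_ : ℕ.NonZero n}} → ℤ → Fin n
vert n z = fromℕ< (n%ℕd<d z n)

vtx-vert : ∀ n .{{_ : ℕ.NonZero n}} z → Cong n (vtx (vert n z)) z
vtx-vert n z = by (divides (- (z /ℕ n))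
  (trans (cong₂ _-_ (cong +_ (toℕ-fromℕ< (n%ℕd<d z n))) (a≡a%ℕn+[a/ℕn]*n z n)) (e (+ (z %ℕ n)) (z /ℕ n) (+ n))))
  where
  e : ∀ r q n → r - (r + q * n) ≡ - q * n
  e = solve-∀

module _ {n : ℕ} {g : Fin 5 → ℤ} where

  jump : ∀ i j → Adj n g i j → ∃ λ t → ∃ λ ε → ∣ ε ∣ ≡ 1 × Cong n (vtx j - vtx i) (ε * g t)
  jump i j (t , inj₁ q) = t , 1ℤ  , refl , subst (Cong n (vtx j - vtx i)) (sym (*-identityˡ (g t))) (by (∣ᵤ⇒∣ q))
  jump i j (t , inj₂ q) = t , -1ℤ , refl , subst (Cong n (vtx j - vtx i)) (sym (-1*i≡-i (g t))) (by (∣ᵤ⇒∣ q))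

  -- A step along ±gₜ adds ±1 to coordinate t, which raises the norm by at most 1.
  displacement : ∀ {d i j} → Walk n g d i j → ∃ λ x → norm x ℕ.≤ d × Cong n (vtx j - vtx i) (φ g x)
  displacement {i = i} here = Vec.replicate 5 0ℤ , ℕ.z≤n ,
    by (divides 0ℤ (trans (cong₂ _-_ (i≡j⇒i-j≡0 {vtx i} refl) (φ-zeros g)) (sym (*-zeroˡ (+ n)))))
  displacement {i = i} {l} (step {j = j} a w) with jump i j a | displacement w
  ... | t , ε , ∣ε∣≡1 , q | x , ≤d , p =
      Vec.updateAt x t (_+_ ε) ,
      ℕ.≤-trans (norm-updateAt x t ε) (ℕ.+-mono-≤ (ℕ.≤-reflexive ∣ε∣≡1) ≤d) ,
      Cong-via (∣m∣n⇒∣m+n (difference q) (difference p))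
        (trans (e (vtx i) (vtx j) (vtx l) (ε * g t) (φ g x))
          (cong (_-_ (vtx l - vtx i)) (sym (φ-updateAt g x t ε))))
    where
    e : ∀ i j l h b → j - i - h + (l - j - b) ≡ l - i - (h + b)
    e = solve-∀

  module _ .{{_ : ℕ.NonZero n}} where

    -- Converse of `displacement`: the coordinates are used up from left to right, `run` taking the
    -- ∣xⱼ∣ equal steps for one of them. `τ` places the remaining coordinates among the five
    -- generators, as `Adj` requires an index in `Fin 5`.
    walk : ∀ {r} (τ : Fin r → Fin 5) x {i j} → Cong n (vtx j - vtx i) (φ (g ∘ τ) x) → Walk n g (norm x) i j
    run  : ∀ {r} (τ : Fin (suc r) → Fin 5) ε c x {i j} →
      Cong n (vtx j - vtx i) (ε • + c * g (τ Fin.zero) + φ (g ∘ τ ∘ Fin.suc) x) → Walk n g (c ℕ.+ norm x) i j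

    walk τ [] {i} {j} p with vtx-injective {n} {i} {j} (Cong-via (difference p) (+-identityʳ (vtx j - vtx i)))
    ... | refl = here
    walk τ (+ c      ∷ x) p = run τ Sign.+ c x p
    walk τ (-[1+ c ] ∷ x) p = run τ Sign.- (suc c) x p

    run τ ε zero x {i} {j} p = walk (τ ∘ Fin.suc) x (Cong-via (difference p)
        (e ε (vtx j - vtx i) (g (τ Fin.zero)) (φ (g ∘ τ ∘ Fin.suc) x)))
      where
      e : ∀ ε a g b → a - (ε • 0ℤ * g + b) ≡ a - b
      e Sign.+ a g b = cong (_-_ a) (trans (cong (_+ b) (*-zeroˡ g)) (+-identityˡ b))
      e Sign.- a g b = cong (_-_ a) (trans (cong (_+ b) (*-zeroˡ g)) (+-identityˡ b))
    run τ ε (suc c) x {i} {j} p = step {j = i′} (τ Fin.zero , adj ε refl) (run τ ε c x (Cong-via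
        (∣m∣n⇒∣m+n (difference (subst (λ z → Cong n (vtx j - vtx i) (z + b)) (•-suc ε (+ c) h) p))
          (∣m⇒∣-m (difference (vtx-vert n (vtx i + ε • h)))))
        (e (vtx j) (vtx i) (vtx i′) (ε • h) (ε • + c * h) b)))
      where
      h = g (τ Fin.zero)
      b = φ (g ∘ τ ∘ Fin.suc) x
      i′ = vert n (vtx i + ε • h)
      e : ∀ j i i′ k l b → j - i - (k + l + b) + - (i′ - (i + k)) ≡ j - i′ - (l + b)
      e = solve-∀
      e′ : ∀ i i′ h → i′ - (i + h) ≡ i′ - i - h
      e′ = solve-∀
      -- Matching on the equation turns `ε` itself into a constructor, so that `i′` reduces along
      -- with the goal.
      adj : ∀ ε′ → ε ≡ ε′ → ((vtx i′ - vtx i) ≡ h [mod n ]) ⊎ ((vtx i′ - vtx i) ≡ - h [mod n ])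
      adj Sign.+ refl = inj₁ (∣⇒∣ᵤ (subst (+ n ∣ₛ_) (e′ (vtx i) (vtx i′) h) (difference (vtx-vert n (vtx i + h)))))
      adj Sign.- refl = inj₂ (∣⇒∣ᵤ (subst (+ n ∣ₛ_) (e′ (vtx i) (vtx i′) (- h)) (difference (vtx-vert n (vtx i + - h)))))

-- A deep hole of the lattice

Unit : ℤ → Set
Unit σ = σ ≡ 1ℤ ⊎ σ ≡ -1ℤ

unit≤1 : ∀ {σ} → Unit σ → σ ≤ 1ℤ
unit≤1 (inj₁ refl) = ≤-refl
unit≤1 (inj₂ refl) = -≤+

-1≤unit : ∀ {σ} → Unit σ → -1ℤ ≤ σ
-1≤unit (inj₁ refl) = -≤+
-1≤unit (inj₂ refl) = ≤-refl

unit*≤abs : ∀ {σ} → Unit σ → ∀ x → σ * x ≤ + ∣ x ∣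
unit*≤abs (inj₁ refl) x = subst (_≤ + ∣ x ∣) (sym (*-identityˡ x)) (i≤+∣i∣ x)
unit*≤abs (inj₂ refl) x = subst₂ _≤_ (sym (-1*i≡-i x)) (cong +_ (∣-i∣≡∣i∣ x)) (i≤+∣i∣ (- x))

-- With h = σD and h′ = σ′D′ the right side is σσ′(h′ - h) ≥ -∣h - h′∣ = 2 min(h, h′) - h - h′, and
-- both h and h′ are at least 1.
edge : ∀ {σ σ′} → Unit σ → Unit σ′ → ∀ D D′ → 1ℤ ≤ σ * D → 1ℤ ≤ σ′ * D′ →
  + 2 - σ * D - σ′ * D′ ≤ σ * D′ - σ′ * D
edge (inj₁ refl) (inj₁ refl) D D′ p q = ≤-via (+-mono-≤ q q) (e D D′)
  where
  e : ∀ D D′ → 1ℤ * D′ + 1ℤ * D′ - (1ℤ + 1ℤ) ≡ 1ℤ * D′ - 1ℤ * D - (+ 2 - 1ℤ * D - 1ℤ * D′)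
  e = solve-∀
edge (inj₁ refl) (inj₂ refl) D D′ p q = ≤-via (+-mono-≤ p p) (e D D′)
  where
  e : ∀ D D′ → 1ℤ * D + 1ℤ * D - (1ℤ + 1ℤ) ≡ 1ℤ * D′ - -1ℤ * D - (+ 2 - 1ℤ * D - -1ℤ * D′)
  e = solve-∀
edge (inj₂ refl) (inj₁ refl) D D′ p q = ≤-via (+-mono-≤ p p) (e D D′)
  where
  e : ∀ D D′ → -1ℤ * D + -1ℤ * D - (1ℤ + 1ℤ) ≡ -1ℤ * D′ - 1ℤ * D - (+ 2 - -1ℤ * D - 1ℤ * D′)
  e = solve-∀
edge (inj₂ refl) (inj₂ refl) D D′ p q = ≤-via (+-mono-≤ q q) (e D D′)
  where
  e : ∀ D D′ → -1ℤ * D′ + -1ℤ * D′ - (1ℤ + 1ℤ) ≡ -1ℤ * D′ - -1ℤ * D - (+ 2 - -1ℤ * D - -1ℤ * D′)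
  e = solve-∀

-- `H` is ∣1 - 2c∣, an odd number: it is 1 for c = 0 and c = 1, and at least 3 otherwise.
record Nearest (c : ℤ) : Set where
  field
    σ    : ℤ
    unit : Unit σ
  H = σ * (1ℤ - + 2 * c)
  field
    1≤H  : 1ℤ ≤ H
    case : + 3 ≤ H ⊎ (c ≡ 0ℤ × σ ≡ 1ℤ) ⊎ (c ≡ 1ℤ × σ ≡ -1ℤ)

nearest : ∀ c → Nearest c
nearest (+ 0) = record { σ = 1ℤ ; unit = inj₁ refl ; 1≤H = ≤-refl ; case = inj₂ (inj₁ (refl , refl)) }
nearest (+ 1) = record { σ = -1ℤ ; unit = inj₂ refl ; 1≤H = ≤-refl ; case = inj₂ (inj₂ (refl , refl)) }
nearest c@(+[1+ suc n ]) = record { σ = -1ℤ ; unit = inj₂ refl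
  ; 1≤H = ≤-trans (+≤+ (ℕ.s≤s ℕ.z≤n)) far ; case = inj₁ far }
  where
  e : ∀ c → c + c - (+ 2 + + 2) ≡ -1ℤ * (1ℤ - + 2 * c) - + 3
  e = solve-∀
  2≤c : + 2 ≤ c
  2≤c = +≤+ (ℕ.s≤s (ℕ.s≤s ℕ.z≤n))
  far : + 3 ≤ -1ℤ * (1ℤ - + 2 * c)
  far = ≤-via (+-mono-≤ 2≤c 2≤c) (e c)
nearest c@(-[1+ n ]) = record { σ = 1ℤ ; unit = inj₁ refl
  ; 1≤H = ≤-trans (+≤+ (ℕ.s≤s ℕ.z≤n)) far ; case = inj₁ far }
  where
  e : ∀ c → -1ℤ + -1ℤ - (c + c) ≡ 1ℤ * (1ℤ - + 2 * c) - + 3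
  e = solve-∀
  c≤-1 : c ≤ -1ℤ
  c≤-1 = -≤- ℕ.z≤n
  far : + 3 ≤ 1ℤ * (1ℤ - + 2 * c)
  far = ≤-via (+-mono-≤ c≤-1 c≤-1) (e c)

2*i≢1 : ∀ i → + 2 * i ≢ 1ℤ
2*i≢1 (+ 0) ()
2*i≢1 +[1+ 0 ] ()
2*i≢1 +[1+ suc n ] ()
2*i≢1 -[1+ n ] ()

side : ℤ → ℤ
side M = + 3 + M * + 6

-- w/2 is (s/2 , s/2 , (s − 1)/2 , (s + 2)/2 , (s − 1)/2); its half-integers are
-- rounded so that the norm becomes k.
hole : ℤ → Vec ℤ 5
hole M = + 2 + M * + 3 ∷ + 1 + M * + 3 ∷ + 1 + M * + 3 ∷ + 2 + M * + 3 ∷ + 1 + M * + 3 ∷ []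

module _ (M : ℤ) (0≤M : 0ℤ ≤ M) where

  private s = side M

  hole-deep : ∀ c → + 7 + M * + 15 ≤ + norm (hole M ⊖ᵥ lattice s c)
  -- Solving Dⱼ = 1 - 2(b + 2aⱼ) for aⱼ produces quarters, hence the factor 4.
  hole-deep (b , a₁ ∷ a₂ ∷ a₃ ∷ a₄ ∷ a₅ ∷ []) = *-cancelˡ-≤-pos (+ 7 + M * + 15) _ (+ 4) goal
    where
    module N₁ = Nearest (nearest (b + + 2 * a₁))
    module N₂ = Nearest (nearest (b + + 2 * a₂))
    module N₃ = Nearest (nearest (b + + 2 * a₃))
    module N₄ = Nearest (nearest (b + + 2 * a₄))
    module N₅ = Nearest (nearest (b + + 2 * a₅))
    D : ℤ → ℤ
    D a = 1ℤ - + 2 * (b + + 2 * a)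
    x = hole M ⊖ᵥ lattice s (b , a₁ ∷ a₂ ∷ a₃ ∷ a₄ ∷ a₅ ∷ [])
    x₁ = + 2 + M * + 3 - ((b + + 2 * a₁) * s + (- a₄ + a₅))
    x₂ = + 1 + M * + 3 - ((b + + 2 * a₂) * s + (a₃ - a₄))
    x₃ = + 1 + M * + 3 - ((b + + 2 * a₃) * s + (- a₂ - a₄ - b))
    x₄ = + 2 + M * + 3 - ((b + + 2 * a₄) * s + (a₁ + a₂ + a₃ + a₅ + + 2 * b))
    x₅ = + 1 + M * + 3 - ((b + + 2 * a₅) * s + (- a₁ - a₄ - b))
    ΣH = N₁.H + (N₂.H + (N₃.H + (N₄.H + N₅.H)))
    τ = N₁.σ - N₂.σ - N₄.σ

    Σσx≤norm : N₁.σ * x₁ + (N₂.σ * x₂ + (N₃.σ * x₃ + (N₄.σ * x₄ + (N₅.σ * x₅ + 0ℤ)))) ≤ + norm x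
    Σσx≤norm = +-mono-≤ (unit*≤abs N₁.unit x₁) (+-mono-≤ (unit*≤abs N₂.unit x₂)
      (+-mono-≤ (unit*≤abs N₃.unit x₃) (+-mono-≤ (unit*≤abs N₄.unit x₄)
      (+-mono-≤ (unit*≤abs N₅.unit x₅) ≤-refl))))

    edges : ℤ
    edges = (N₁.σ * D a₅ - N₅.σ * D a₁) + ((N₄.σ * D a₁ - N₁.σ * D a₄) + ((N₂.σ * D a₃ - N₃.σ * D a₂)
      + ((N₄.σ * D a₂ - N₂.σ * D a₄) + ((N₄.σ * D a₃ - N₃.σ * D a₄) + (N₄.σ * D a₅ - N₅.σ * D a₄)))))

    edges≥ : (+ 2 - N₁.H - N₅.H) + ((+ 2 - N₄.H - N₁.H) + ((+ 2 - N₂.H - N₃.H)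
      + ((+ 2 - N₄.H - N₂.H) + ((+ 2 - N₄.H - N₃.H) + (+ 2 - N₄.H - N₅.H))))) ≤ edges
    edges≥ = +-mono-≤ (edge N₁.unit N₅.unit _ _ N₁.1≤H N₅.1≤H) (+-mono-≤ (edge N₄.unit N₁.unit _ _ N₄.1≤H N₁.1≤H)
      (+-mono-≤ (edge N₂.unit N₃.unit _ _ N₂.1≤H N₃.1≤H) (+-mono-≤ (edge N₄.unit N₂.unit _ _ N₄.1≤H N₂.1≤H)
      (+-mono-≤ (edge N₄.unit N₃.unit _ _ N₄.1≤H N₃.1≤H) (edge N₄.unit N₅.unit _ _ N₄.1≤H N₅.1≤H)))))

    -- 4 Σ σⱼxⱼ = 2s Σ σⱼDⱼ + 2τ + Σ (σᵢDⱼ − σⱼDᵢ), the last sum being over the pairs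
    -- {i , j} with Aᵢⱼ ≠ 0, suitably ordered.
    expand : ∀ M b a₁ a₂ a₃ a₄ a₅ σ₁ σ₂ σ₃ σ₄ σ₅ →
      + 4 * (σ₁ * (+ 2 + M * + 3 - ((b + + 2 * a₁) * (+ 3 + M * + 6) + (- a₄ + a₅)))
        + (σ₂ * (+ 1 + M * + 3 - ((b + + 2 * a₂) * (+ 3 + M * + 6) + (a₃ - a₄)))
        + (σ₃ * (+ 1 + M * + 3 - ((b + + 2 * a₃) * (+ 3 + M * + 6) + (- a₂ - a₄ - b)))
        + (σ₄ * (+ 2 + M * + 3 - ((b + + 2 * a₄) * (+ 3 + M * + 6) + (a₁ + a₂ + a₃ + a₅ + + 2 * b)))
        + (σ₅ * (+ 1 + M * + 3 - ((b + + 2 * a₅) * (+ 3 + M * + 6) + (- a₁ - a₄ - b))) + 0ℤ)))))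
      ≡ (+ 6 + M * + 12) * (σ₁ * (1ℤ - + 2 * (b + + 2 * a₁)) + (σ₂ * (1ℤ - + 2 * (b + + 2 * a₂))
        + (σ₃ * (1ℤ - + 2 * (b + + 2 * a₃)) + (σ₄ * (1ℤ - + 2 * (b + + 2 * a₄)) + σ₅ * (1ℤ - + 2 * (b + + 2 * a₅))))))
        + + 2 * (σ₁ - σ₂ - σ₄)
        + ((σ₁ * (1ℤ - + 2 * (b + + 2 * a₅)) - σ₅ * (1ℤ - + 2 * (b + + 2 * a₁)))
        + ((σ₄ * (1ℤ - + 2 * (b + + 2 * a₁)) - σ₁ * (1ℤ - + 2 * (b + + 2 * a₄)))
        + ((σ₂ * (1ℤ - + 2 * (b + + 2 * a₃)) - σ₃ * (1ℤ - + 2 * (b + + 2 * a₂)))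
        + ((σ₄ * (1ℤ - + 2 * (b + + 2 * a₂)) - σ₂ * (1ℤ - + 2 * (b + + 2 * a₄)))
        + ((σ₄ * (1ℤ - + 2 * (b + + 2 * a₃)) - σ₃ * (1ℤ - + 2 * (b + + 2 * a₄)))
        + (σ₄ * (1ℤ - + 2 * (b + + 2 * a₅)) - σ₅ * (1ℤ - + 2 * (b + + 2 * a₄))))))))
    expand = solve-∀

    bound : (+ 2 + M * + 12) * ΣH + + 2 * τ + + 20 ≤ + 4 * + norm x
    bound = begin
      (+ 2 + M * + 12) * ΣH + + 2 * τ + + 20
        -- Index 4 occurs in four of the six pairs, every other index in two. So the pairs give at
        -- least 12 - 4H₄ - 2(H₁ + H₂ + H₃ + H₅), which is at least 20 - 4ΣH because each H is at
        -- least 1.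
        ≤⟨ ≤-via (+-mono-≤ edges≥ (+-mono-≤ 1s 1s)) (e M N₁.H N₂.H N₃.H N₄.H N₅.H τ edges) ⟩
      (+ 6 + M * + 12) * ΣH + + 2 * τ + edges
        ≡⟨ sym (expand M b a₁ a₂ a₃ a₄ a₅ N₁.σ N₂.σ N₃.σ N₄.σ N₅.σ) ⟩
      + 4 * _  ≤⟨ *-monoˡ-≤-nonNeg (+ 4) Σσx≤norm ⟩
      + 4 * + norm x ∎
      where
      1s = +-mono-≤ N₁.1≤H (+-mono-≤ N₂.1≤H (+-mono-≤ N₃.1≤H N₅.1≤H))
      e : ∀ M h₁ h₂ h₃ h₄ h₅ τ g → g + ((h₁ + (h₂ + (h₃ + h₅))) + (h₁ + (h₂ + (h₃ + h₅))))
          - ((+ 2 - h₁ - h₅) + ((+ 2 - h₄ - h₁) + ((+ 2 - h₂ - h₃)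
          + ((+ 2 - h₄ - h₂) + ((+ 2 - h₄ - h₃) + (+ 2 - h₄ - h₅))))) + (+ 4 + + 4))
        ≡ (+ 6 + M * + 12) * (h₁ + (h₂ + (h₃ + (h₄ + h₅)))) + + 2 * τ + g
          - ((+ 2 + M * + 12) * (h₁ + (h₂ + (h₃ + (h₄ + h₅)))) + + 2 * τ + + 20)
      e = solve-∀

    finish : ∀ {h t} → h ≤ ΣH → t ≤ τ → + 28 + M * + 60 ≤ (+ 2 + M * + 12) * h + + 2 * t + + 20 →
      + 4 * (+ 7 + M * + 15) ≤ + 4 * + norm x
    finish {h} {t} p q r = begin
      + 4 * (+ 7 + M * + 15)                    ≡⟨ e M ⟩
      + 28 + M * + 60                           ≤⟨ r ⟩
      (+ 2 + M * + 12) * h + + 2 * t + + 20     ≤⟨ +-monoˡ-≤ (+ 20)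
        (+-mono-≤ (*-monoˡ-≤-nonNeg (+ 2 + M * + 12) {{nn}} p) (*-monoˡ-≤-nonNeg (+ 2) q)) ⟩
      (+ 2 + M * + 12) * ΣH + + 2 * τ + + 20    ≤⟨ bound ⟩
      + 4 * + norm x ∎
      where
      nn : NonNegative (+ 2 + M * + 12)
      nn = nonNegative (+-mono-≤ {0ℤ} {+ 2} (+≤+ ℕ.z≤n) (*-monoʳ-≤-nonNeg (+ 12) 0≤M))
      e : ∀ M → + 4 * (+ 7 + M * + 15) ≡ + 28 + M * + 60
      e = solve-∀

    far : + 7 ≤ ΣH → + 4 * (+ 7 + M * + 15) ≤ + 4 * + norm x
    far p = finish p
      (+-mono-≤ (+-mono-≤ (-1≤unit N₁.unit) (neg-mono-≤ (unit≤1 N₂.unit))) (neg-mono-≤ (unit≤1 N₄.unit)))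
      (≤-via (*-monoʳ-≤-nonNeg (+ 24) 0≤M) (e M))
      where
      e : ∀ M → M * + 24 - 0ℤ * + 24 ≡ (+ 2 + M * + 12) * + 7 + + 2 * - + 3 + + 20 - (+ 28 + M * + 60)
      e = solve-∀

    near : -1ℤ ≤ τ → + 4 * (+ 7 + M * + 15) ≤ + 4 * + norm x
    near q = finish {+ 5} (+-mono-≤ N₁.1≤H (+-mono-≤ N₂.1≤H (+-mono-≤ N₃.1≤H (+-mono-≤ N₄.1≤H N₅.1≤H)))) q
      (≤-reflexive (e M))
      where
      e : ∀ M → + 28 + M * + 60 ≡ (+ 2 + M * + 12) * + 5 + + 2 * -1ℤ + + 20
      e = solve-∀

    goal : + 4 * (+ 7 + M * + 15) ≤ + 4 * + norm x
    -- If H₁ or H₂ is at least 3, then ΣH ≥ 7 makes up for τ = -3. Otherwise ΣH = 5 suffices as long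
    -- as τ ≥ -1, with equality in the estimate. This fails only for σ₁ = -1 and σ₂ = 1, that is c₁
    -- = 1 and c₂ = 0, which the common parity of the cⱼ excludes.
    goal with N₁.case | N₂.case
    ... | inj₁ 3≤H | _ = far (+-mono-≤ 3≤H (+-mono-≤ N₂.1≤H (+-mono-≤ N₃.1≤H (+-mono-≤ N₄.1≤H N₅.1≤H))))
    ... | _ | inj₁ 3≤H = far (+-mono-≤ N₁.1≤H (+-mono-≤ 3≤H (+-mono-≤ N₃.1≤H (+-mono-≤ N₄.1≤H N₅.1≤H))))
    ... | inj₂ (inj₁ (_ , σ₁≡1)) | _ = near
      (+-mono-≤ (+-mono-≤ (≤-reflexive (sym σ₁≡1)) (neg-mono-≤ (unit≤1 N₂.unit))) (neg-mono-≤ (unit≤1 N₄.unit)))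
    ... | _ | inj₂ (inj₂ (_ , σ₂≡-1)) = near
      (+-mono-≤ (+-mono-≤ (-1≤unit N₁.unit) (neg-mono-≤ (≤-reflexive σ₂≡-1))) (neg-mono-≤ (unit≤1 N₄.unit)))
    ... | inj₂ (inj₂ (c₁≡1 , _)) | inj₂ (inj₁ (c₂≡0 , _)) =
      ⊥-elim (2*i≢1 (a₁ - a₂) (trans (e b a₁ a₂) (cong₂ _-_ c₁≡1 c₂≡0)))
      where
      e : ∀ b a₁ a₂ → + 2 * (a₁ - a₂) ≡ (b + + 2 * a₁) - (b + + 2 * a₂)
      e = solve-∀

-- Polynomial identities in one variable

poly : List ℤ → ℤ → ℤ
poly []       x = 0ℤ
poly (c ∷ cs) x = c + x * poly cs x

polyℕ : List ℕ → ℤ → ℤ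
polyℕ p = poly (List.map +_ p)

infixl 6 _⊕_
_⊕_ : List ℤ → List ℤ → List ℤ
[]      ⊕ q       = q
p       ⊕ []      = p
(c ∷ p) ⊕ (d ∷ q) = c + d ∷ p ⊕ q

_⊙_ : ℤ → List ℤ → List ℤ
c ⊙ p = List.map (_*_ c) p

infixl 7 _⊗_
_⊗_ : List ℤ → List ℤ → List ℤ
[]      ⊗ q = []
(c ∷ p) ⊗ q = c ⊙ q ⊕ (0ℤ ∷ p ⊗ q)

poly-⊕ : ∀ p q x → poly (p ⊕ q) x ≡ poly p x + poly q x
poly-⊕ []      q       x = sym (+-identityˡ _)
poly-⊕ (c ∷ p) []      x = sym (+-identityʳ _)
poly-⊕ (c ∷ p) (d ∷ q) x = trans (cong (λ r → c + d + x * r) (poly-⊕ p q x)) (e c d x (poly p x) (poly q x))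
  where
  e : ∀ c d x p q → c + d + x * (p + q) ≡ c + x * p + (d + x * q)
  e = solve-∀

poly-⊙ : ∀ c p x → poly (c ⊙ p) x ≡ c * poly p x
poly-⊙ c []      x = sym (*-zeroʳ c)
poly-⊙ c (d ∷ p) x = trans (cong (λ r → c * d + x * r) (poly-⊙ c p x)) (e c d x (poly p x))
  where
  e : ∀ c d x p → c * d + x * (c * p) ≡ c * (d + x * p)
  e = solve-∀

poly-⊗ : ∀ p q x → poly (p ⊗ q) x ≡ poly p x * poly q x
poly-⊗ []      q x = sym (*-zeroˡ (poly q x))
poly-⊗ (c ∷ p) q x = trans (poly-⊕ (c ⊙ q) (0ℤ ∷ p ⊗ q) x)
  (trans (cong₂ (λ u v → u + (0ℤ + x * v)) (poly-⊙ c q x) (poly-⊗ p q x)) (e c x (poly p x) (poly q x)))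
  where
  e : ∀ c x p q → c * q + (0ℤ + x * (p * q)) ≡ (c + x * p) * q
  e = solve-∀

infixl 6 _⊞_ _⊟_
infixl 7 _⊠_
infixr 8 _↑_
data Expr : Set where
  var         : Expr
  con         : ℤ → Expr
  ⟨_⟩         : List ℕ → Expr
  _⊞_ _⊟_ _⊠_ : Expr → Expr → Expr
  _↑_         : Expr → ℕ → Expr

value : Expr → ℤ → ℤ
value var     x = x
value (con c) x = c
value ⟨ p ⟩   x = polyℕ p x
value (e ⊞ f) x = value e x + value f x
value (e ⊟ f) x = value e x - value f x
value (e ⊠ f) x = value e x * value f x
value (e ↑ n) x = value e x ^ n

coeffs : Expr → List ℤ
coeffs var     = 0ℤ ∷ 1ℤ ∷ []
coeffs (con c) = c ∷ []
coeffs ⟨ p ⟩   = List.map +_ p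
coeffs (e ⊞ f) = coeffs e ⊕ coeffs f
coeffs (e ⊟ f) = coeffs e ⊕ -1ℤ ⊙ coeffs f
coeffs (e ⊠ f) = coeffs e ⊗ coeffs f
coeffs (e ↑ n) = List.foldr _⊗_ (1ℤ ∷ []) (List.replicate n (coeffs e))

value-coeffs : ∀ e x → value e x ≡ poly (coeffs e) x
value-coeffs var x = e x
  where
  e : ∀ x → x ≡ 0ℤ + x * (1ℤ + x * 0ℤ)
  e = solve-∀
value-coeffs (con c) x = sym (trans (cong (_+_ c) (*-zeroʳ x)) (+-identityʳ c))
value-coeffs ⟨ p ⟩ x = refl
value-coeffs (e ⊞ f) x = trans (cong₂ _+_ (value-coeffs e x) (value-coeffs f x)) (sym (poly-⊕ (coeffs e) (coeffs f) x))
value-coeffs (e ⊟ f) x = trans (cong₂ _-_ (value-coeffs e x) (value-coeffs f x))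
  (sym (trans (poly-⊕ (coeffs e) (-1ℤ ⊙ coeffs f) x) (cong (_+_ (poly (coeffs e) x))
    (trans (poly-⊙ -1ℤ (coeffs f) x) (-1*i≡-i _)))))
value-coeffs (e ⊠ f) x = trans (cong₂ _*_ (value-coeffs e x) (value-coeffs f x)) (sym (poly-⊗ (coeffs e) (coeffs f) x))
value-coeffs (e ↑ n) x = power n
  where
  power : ∀ n → value e x ^ n ≡ poly (coeffs (e ↑ n)) x
  power zero    = sym (cong (_+_ 1ℤ) (*-zeroʳ x))
  power (suc n) = trans (cong₂ _*_ (value-coeffs e x) (power n)) (sym (poly-⊗ (coeffs e) _ x))

-- Substitution on the level of syntax, needed to pass from polynomials in k to polynomials in m.
_⟪_⟫ : Expr → Expr → Expr
var     ⟪ d ⟫ = d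
con c   ⟪ d ⟫ = con c
⟨ p ⟩   ⟪ d ⟫ = List.foldr (λ c e → con (+ c) ⊞ d ⊠ e) (con 0ℤ) p
(e ⊞ f) ⟪ d ⟫ = e ⟪ d ⟫ ⊞ f ⟪ d ⟫
(e ⊟ f) ⟪ d ⟫ = e ⟪ d ⟫ ⊟ f ⟪ d ⟫
(e ⊠ f) ⟪ d ⟫ = e ⟪ d ⟫ ⊠ f ⟪ d ⟫
(e ↑ n) ⟪ d ⟫ = e ⟪ d ⟫ ↑ n

value-⟪⟫ : ∀ e d x → value (e ⟪ d ⟫) x ≡ value e (value d x)
value-⟪⟫ var     d x = refl
value-⟪⟫ (con c) d x = refl
value-⟪⟫ ⟨ p ⟩   d x = horner p
  where
  horner : ∀ p → value (⟨ p ⟩ ⟪ d ⟫) x ≡ polyℕ p (value d x)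
  horner []      = refl
  horner (c ∷ p) = cong (λ r → + c + value d x * r) (horner p)
value-⟪⟫ (e ⊞ f) d x = cong₂ _+_ (value-⟪⟫ e d x) (value-⟪⟫ f d x)
value-⟪⟫ (e ⊟ f) d x = cong₂ _-_ (value-⟪⟫ e d x) (value-⟪⟫ f d x)
value-⟪⟫ (e ⊠ f) d x = cong₂ _*_ (value-⟪⟫ e d x) (value-⟪⟫ f d x)
value-⟪⟫ (e ↑ n) d x = cong (_^ n) (value-⟪⟫ e d x)

isZero : List ℤ → Bool
isZero = all (λ c → ⌊ c ≟ 0ℤ ⌋)

poly-zero : ∀ p → T (isZero p) → ∀ x → poly p x ≡ 0ℤ
poly-zero []      _ x = refl
poly-zero (c ∷ p) t x with Equivalence.to T-∧ t
... | c≡0 , t′ = trans (cong₂ (λ u v → u + x * v) (toWitness c≡0) (poly-zero p t′ x))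
  (trans (+-identityˡ _) (*-zeroʳ x))

-- Proof by reflection: the coefficients of `e ⊟ f` are closed integers, so the implicit argument is
-- found by evaluation.
solve-poly : ∀ e f → {T (isZero (coeffs (e ⊟ f)))} → ∀ x → value e x ≡ value f x
solve-poly e f {t} x = i-j≡0⇒i≡j _ _ (trans (value-coeffs (e ⊟ f) x) (poly-zero (coeffs (e ⊟ f)) t x))

poly-nonNeg : ∀ cs m → 0ℤ ≤ polyℕ cs (+ m)
poly-nonNeg []       m = ≤-refl
poly-nonNeg (c ∷ cs) m = +-mono-≤ {0ℤ} {+ c} {0ℤ} {+ m * r} (+≤+ ℕ.z≤n)
  (subst (_≤ + m * r) (*-zeroʳ (+ m)) (*-monoˡ-≤-nonNeg (+ m) (poly-nonNeg cs m)))
  where r = polyℕ cs (+ m)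

-- The coefficients in m, constant term first, of the order n and of the generators.
N G₂ G₃ G₄ G₅ : List ℕ
N  = 4551 ∷ 42798 ∷ 163296 ∷ 316224 ∷ 311040 ∷ 124416 ∷ []
G₂ = 739 ∷ 5544 ∷ 15912 ∷ 20736 ∷ 10368 ∷ []
G₃ = 1178 ∷ 11922 ∷ 48216 ∷ 97920 ∷ 100224 ∷ 41472 ∷ []
G₄ = 1295 ∷ 12588 ∷ 49512 ∷ 98784 ∷ 100224 ∷ 41472 ∷ []
G₅ = 1301 ∷ 12600 ∷ 49512 ∷ 98784 ∷ 100224 ∷ 41472 ∷ []

-- Written so that `value` at `+ k` unfolds to `numN k`, `num2 k` and so on.
numeratorₙ numerator₂ numerator₃ numerator₄ numerator₅ : Expr
numeratorₙ = con (+ 512) ⊠ var ↑ 5 ⊞ con (+ 1280) ⊠ var ↑ 4 ⊞ con (+ 6080) ⊠ var ↑ 3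
  ⊞ con (+ 7840) ⊠ var ↑ 2 ⊞ con (+ 10010) ⊠ var ⊞ con (+ 3741)
numerator₂ = con (+ 128) ⊠ var ↑ 4 ⊞ con (+ 256) ⊠ var ↑ 3 ⊞ con (+ 1192) ⊠ var ↑ 2 ⊞ con (+ 1064) ⊠ var ⊞ con (+ 883)
numerator₃ = con (+ 512) ⊠ var ↑ 5 ⊞ con (+ 640) ⊠ var ↑ 4 ⊞ con (+ 3200) ⊠ var ↑ 3
  ⊟ con (+ 2520) ⊠ var ↑ 2 ⊟ con (+ 8510) ⊠ var ⊟ con (+ 12624)
numerator₄ = con (+ 512) ⊠ var ↑ 5 ⊞ con (+ 640) ⊠ var ↑ 4 ⊞ con (+ 5600) ⊠ var ↑ 3
  ⊞ con (+ 1080) ⊠ var ↑ 2 ⊞ con (+ 4540) ⊠ var ⊟ con (+ 6699)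
numerator₅ = con (+ 512) ⊠ var ↑ 5 ⊞ con (+ 640) ⊠ var ↑ 4 ⊞ con (+ 5600) ⊠ var ↑ 3
  ⊞ con (+ 1080) ⊠ var ↑ 2 ⊞ con (+ 12040) ⊠ var ⊟ con (+ 2949)

at-7+15* : ∀ e p d k M → + k ≡ + 7 + M * + 15 →
  {T (isZero (coeffs (e ⟪ con (+ 7) ⊞ var ⊠ con (+ 15) ⟫ ⊟ ⟨ p ⟩ ⊠ con (+ d))))} →
  value e (+ k) ≡ polyℕ p M * + d
at-7+15* e p d k M k≡ {t} = trans (cong (value e) k≡)
  (trans (sym (value-⟪⟫ e _ M)) (solve-poly (e ⟪ con (+ 7) ⊞ var ⊠ con (+ 15) ⟫) (⟨ p ⟩ ⊠ con (+ d)) {t} M))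

module _ (k : ℕ) (M : ℤ) (k≡ : + k ≡ + 7 + M * + 15) where

  numN≡ : numN k ≡ polyℕ N M * + 3125
  numN≡ = at-7+15* numeratorₙ N 3125 k M k≡

  num2≡ : num2 k ≡ polyℕ G₂ M * + 625
  num2≡ = at-7+15* numerator₂ G₂ 625 k M k≡

  num3≡ : num3 k ≡ polyℕ G₃ M * + 9375
  num3≡ = at-7+15* numerator₃ G₃ 9375 k M k≡

  num4≡ : num4 k ≡ polyℕ G₄ M * + 9375
  num4≡ = at-7+15* numerator₄ G₄ 9375 k M k≡

  num5≡ : num5 k ≡ polyℕ G₅ M * + 9375
  num5≡ = at-7+15* numerator₅ G₅ 9375 k M k≡

-- The kernel of φ

γ : ℤ → Fin 5 → ℤ
γ M = Vec.lookup (1ℤ ∷ polyℕ G₂ M ∷ polyℕ G₃ M ∷ polyℕ G₄ M ∷ polyℕ G₅ M ∷ [])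

-- The factors are φ(w)/n and φ(uⱼ)/n; φ(u₁) = 0.
multiple : ℤ → Coeffs → ℤ
multiple M (b , a₁ ∷ a₂ ∷ a₃ ∷ a₄ ∷ a₅ ∷ []) =
  b * (+ 3 + M * + 6) + a₂ * 1ℤ + a₃ * (+ 2 + M * + 4) + a₄ * (1ℤ + M * + 4) + a₅ * (+ 2 + M * + 4)

-- By linearity it suffices to treat w and the five uⱼ, for each of which the claim is a polynomial
-- identity in M.
φ-lattice : ∀ M c → φ (γ M) (lattice (side M) c) ≡ multiple M c * polyℕ N M
φ-lattice M (b , a₁ ∷ a₂ ∷ a₃ ∷ a₄ ∷ a₅ ∷ []) =
  trans (expand (side M) b a₁ a₂ a₃ a₄ a₅ (polyℕ G₂ M) (polyℕ G₃ M) (polyℕ G₄ M) (polyℕ G₅ M))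
  (trans (cong₂ _+_ (cong₂ _+_ (cong₂ _+_ (cong₂ _+_ (cong₂ _+_
     (cong (b *_) (solve-poly (S ⊞ S ⊠ g₂ ⊞ (S ⊟ con 1ℤ) ⊠ g₃ ⊞ (S ⊞ con (+ 2)) ⊠ g₄ ⊞ (S ⊟ con 1ℤ) ⊠ g₅)
       ((con (+ 3) ⊞ var ⊠ con (+ 6)) ⊠ n) M))
     (cong (a₁ *_) (solve-poly (con (+ 2) ⊠ S ⊞ g₄ ⊟ g₅) (con 0ℤ ⊠ n) M)))
     (cong (a₂ *_) (solve-poly (con (+ 2) ⊠ S ⊠ g₂ ⊟ g₃ ⊞ g₄) (con 1ℤ ⊠ n) M)))
     (cong (a₃ *_) (solve-poly (g₂ ⊞ con (+ 2) ⊠ S ⊠ g₃ ⊞ g₄) ((con (+ 2) ⊞ var ⊠ con (+ 4)) ⊠ n) M)))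
     (cong (a₄ *_) (solve-poly (con (+ 2) ⊠ S ⊠ g₄ ⊟ con 1ℤ ⊟ g₂ ⊟ g₃ ⊟ g₅)
       ((con 1ℤ ⊞ var ⊠ con (+ 4)) ⊠ n) M)))
     (cong (a₅ *_) (solve-poly (con 1ℤ ⊞ g₄ ⊞ con (+ 2) ⊠ S ⊠ g₅) ((con (+ 2) ⊞ var ⊠ con (+ 4)) ⊠ n) M)))
  (collect b a₁ a₂ a₃ a₄ a₅ (+ 3 + M * + 6) (+ 2 + M * + 4) (1ℤ + M * + 4) (polyℕ N M)))
  where
  S = con (+ 3) ⊞ var ⊠ con (+ 6)
  g₂ = ⟨ G₂ ⟩
  g₃ = ⟨ G₃ ⟩
  g₄ = ⟨ G₄ ⟩
  g₅ = ⟨ G₅ ⟩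
  n = ⟨ N ⟩
  expand : ∀ s b a₁ a₂ a₃ a₄ a₅ g₂ g₃ g₄ g₅ →
    ((b + + 2 * a₁) * s + (- a₄ + a₅)) * 1ℤ + (((b + + 2 * a₂) * s + (a₃ - a₄)) * g₂
    + (((b + + 2 * a₃) * s + (- a₂ - a₄ - b)) * g₃ + (((b + + 2 * a₄) * s + (a₁ + a₂ + a₃ + a₅ + + 2 * b)) * g₄
    + (((b + + 2 * a₅) * s + (- a₁ - a₄ - b)) * g₅ + 0ℤ))))
    ≡ b * (s + s * g₂ + (s - 1ℤ) * g₃ + (s + + 2) * g₄ + (s - 1ℤ) * g₅) + a₁ * (+ 2 * s + g₄ - g₅)
      + a₂ * (+ 2 * s * g₂ - g₃ + g₄) + a₃ * (g₂ + + 2 * s * g₃ + g₄)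
      + a₄ * (+ 2 * s * g₄ - 1ℤ - g₂ - g₃ - g₅) + a₅ * (1ℤ + g₄ + + 2 * s * g₅)
  expand = solve-∀
  collect : ∀ b a₁ a₂ a₃ a₄ a₅ q₀ q₃ q₄ n →
    b * (q₀ * n) + a₁ * (0ℤ * n) + a₂ * (1ℤ * n) + a₃ * (q₃ * n) + a₄ * (q₄ * n) + a₅ * (q₃ * n)
    ≡ (b * q₀ + a₂ * 1ℤ + a₃ * q₃ + a₄ * q₄ + a₅ * q₃) * n
  collect = solve-∀

-- With a₂ = 0, the coordinates y₃, y₂, y₅ determine b, a₄, a₁ from the remaining
-- coefficients; a₃ and a₄ + a₅ are what inverting the basis gives.  Once the last four
-- coordinates agree, the first one does because φ takes the same value t n.
kernel : ∀ M y t → φ (γ M) y ≡ t * polyℕ N M → ∃ λ c → y ≡ lattice (side M) c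
kernel M (y₁ ∷ y₂ ∷ y₃ ∷ y₄ ∷ y₅ ∷ []) t eq = c , cong₂ _∷_ y₁≡ tail≡
  where
  s = side M
  σ = y₃ + y₄ + y₅
  a₃ = y₂ + (+ 2 + M * + 4) * σ - (+ 7 + M * + 12) * t
  b = (+ 2 * s - 1ℤ) * a₃ + y₂ - y₃
  a₄ = b * s + a₃ - y₂
  a₅ = σ - + 3 * t - a₃ - a₄
  a₁ = (b + + 2 * a₅) * s - a₄ - b - y₅
  c : Coeffs
  c = b , a₁ ∷ 0ℤ ∷ a₃ ∷ a₄ ∷ a₅ ∷ []
  e₂ : ∀ s b a₃ y₂ → y₂ ≡ (b + + 2 * 0ℤ) * s + (a₃ - (b * s + a₃ - y₂))
  e₂ = solve-∀
  e₃ : ∀ s a₃ y₂ y₃ → let b = (+ 2 * s - 1ℤ) * a₃ + y₂ - y₃ in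
    y₃ ≡ (b + + 2 * a₃) * s + (- 0ℤ - (b * s + a₃ - y₂) - b)
  e₃ = solve-∀
  e₄ : ∀ M t y₂ y₃ y₄ y₅ → let
      s = + 3 + M * + 6
      σ = y₃ + y₄ + y₅
      a₃ = y₂ + (+ 2 + M * + 4) * σ - (+ 7 + M * + 12) * t
      b = (+ 2 * s - 1ℤ) * a₃ + y₂ - y₃
      a₄ = b * s + a₃ - y₂
      a₅ = σ - + 3 * t - a₃ - a₄
      a₁ = (b + + 2 * a₅) * s - a₄ - b - y₅
    in y₄ ≡ (b + + 2 * a₄) * s + (a₁ + 0ℤ + a₃ + a₅ + + 2 * b)
  e₄ = solve-∀
  e₅ : ∀ s b a₄ a₅ y₅ → y₅ ≡ (b + + 2 * a₅) * s + (- ((b + + 2 * a₅) * s - a₄ - b - y₅) - a₄ - b)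
  e₅ = solve-∀
  eₜ : ∀ M t y₂ σ b → let
      a₃ = y₂ + (+ 2 + M * + 4) * σ - (+ 7 + M * + 12) * t
      a₄ = b * (+ 3 + M * + 6) + a₃ - y₂
      a₅ = σ - + 3 * t - a₃ - a₄
    in b * (+ 3 + M * + 6) + 0ℤ * 1ℤ + a₃ * (+ 2 + M * + 4) + a₄ * (1ℤ + M * + 4) + a₅ * (+ 2 + M * + 4) ≡ t
  eₜ = solve-∀
  tail≡ : y₂ ∷ y₃ ∷ y₄ ∷ y₅ ∷ [] ≡ Vec.tail (lattice (side M) c)
  tail≡ = cong₂ _∷_ (e₂ s b a₃ y₂) (cong₂ _∷_ (e₃ s a₃ y₂ y₃)
    (cong₂ _∷_ (e₄ M t y₂ y₃ y₄ y₅) (cong₂ _∷_ (e₅ s b a₄ a₅ y₅) refl)))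
  y₁≡ : y₁ ≡ Vec.head (lattice (side M) c)
  y₁≡ = trans (sym (*-identityʳ y₁)) (trans (∙-cancelʳ +-0-abelianGroup _ _ _
    (trans eq (trans (cong (_* polyℕ N M) (sym (eₜ M t y₂ σ b))) (trans (sym (φ-lattice M c))
      (cong (λ v → Vec.head (lattice (side M) c) * 1ℤ + φ (γ M ∘ Fin.suc) v) (sym tail≡)))))) (*-identityʳ _))

-- The diameter for k = 15m + 7

module _ (m k n : ℕ) (g : Fin 5 → ℤ) (k≡ : + k ≡ + 7 + + m * + 15)
         (n≡ : + n ≡ polyℕ N (+ m)) (g≡ : ∀ t → g t ≡ γ (+ m) t) where

  private
    M = + m
    s = side M

    0≤M : 0ℤ ≤ M
    0≤M = +≤+ ℕ.z≤n

    3≤s : + 3 ≤ s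
    3≤s = +-monoʳ-≤ (+ 3) (*-monoʳ-≤-nonNeg (+ 6) 0≤M)

    n∣φ-lattice : ∀ c → + n ∣ₛ φ g (lattice s c)
    n∣φ-lattice c = divides (multiple M c)
      (trans (φ-cong g≡ (lattice s c)) (trans (φ-lattice M c) (cong (multiple M c *_) (sym n≡))))

    Represents : ℤ → Vec ℤ 5 → Set
    Represents z x = Cong n z (φ g x)

    -- The first generator is 1, so every displacement has a representative from which `reduce` can
    -- start.
    on-axis : ∀ z → Represents z (z ∷ 0ℤ ∷ 0ℤ ∷ 0ℤ ∷ 0ℤ ∷ [])
    on-axis z = Cong-via (divides 0ℤ (sym (*-zeroˡ (+ n))))
      (trans (e z (γ M (# 1)) (γ M (# 2)) (γ M (# 3)) (γ M (# 4)))
        (cong (_-_ z) (sym (φ-cong g≡ (z ∷ 0ℤ ∷ 0ℤ ∷ 0ℤ ∷ 0ℤ ∷ [])))))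
      where
      e : ∀ z g₂ g₃ g₄ g₅ → 0ℤ ≡ z - (z * 1ℤ + (0ℤ * g₂ + (0ℤ * g₃ + (0ℤ * g₄ + (0ℤ * g₅ + 0ℤ)))))
      e = solve-∀

    closed : ∀ z x c → Represents z x → Represents z (x ⊖ᵥ lattice s c)
    closed z x c p = Cong-via (∣m∣n⇒∣m+n (difference p) (n∣φ-lattice c))
      (trans (e z (φ g x) (φ g (lattice s c))) (cong (_-_ z) (sym (φ-⊖ᵥ g x (lattice s c)))))
      where
      e : ∀ z a b → z - a + b ≡ z - (a - b)
      e = solve-∀

    -- 5s = 2k + 1 is odd, so halving rounds down to k.
    short⇒≤k : ∀ {l} → + l + + l ≤ + 5 * s → l ℕ.≤ k
    short⇒≤k {l} short = ℕ.≮⇒≥ λ k<l → ℕ.<⇒≱ (ℕ.s≤s (ℕ.≤-reflexive (sym (ℕ.+-suc k k))))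
        (ℕ.≤-trans (ℕ.+-mono-≤ k<l k<l) l+l≤)
      where
      e : ∀ M → + 5 * (+ 3 + M * + 6) ≡ 1ℤ + ((+ 7 + M * + 15) + (+ 7 + M * + 15))
      e = solve-∀
      l+l≤ : l ℕ.+ l ℕ.≤ suc (k ℕ.+ k)
      l+l≤ = drop‿+≤+ (≤-trans short (≤-reflexive (trans (e M) (cong (λ z → 1ℤ + (z + z)) (sym k≡)))))

  module _ .{{_ : ℕ.NonZero n}} where

    diameter-≤ : ∀ i j → DistLe n g k i j
    diameter-≤ i j with reduce s 3≤s (Represents (vtx j - vtx i)) (closed _)
                          (vtx j - vtx i ∷ 0ℤ ∷ 0ℤ ∷ 0ℤ ∷ 0ℤ ∷ []) (on-axis _)
    ... | x , p , short = norm x , short⇒≤k short , walk id x p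

    -- A walk from 0 to φ(p), with p the hole, yields x with φ(x) ≡ φ(p). Then p - x lies in the
    -- kernel, hence in the lattice, and `hole-deep` bounds the norm of x = p - (p - x).
    hole-distance : ∀ d → DistLe n g d (vert n 0ℤ) (vert n (φ g (hole M))) → k ℕ.≤ d
    hole-distance d (l , l≤d , w) with displacement w
    ... | x , norm≤l , p with ∣m∣n⇒∣m+n (∣m∣n⇒∣m+n (difference p) (difference (vtx-vert n 0ℤ)))
                                (∣m⇒∣-m (difference (vtx-vert n (φ g (hole M)))))
    ... | divides q eq with kernel M (hole M ⊖ᵥ x) q (trans (sym (φ-cong g≡ (hole M ⊖ᵥ x)))
            (trans (φ-⊖ᵥ g (hole M) x) (trans
            (e (vtx (vert n (φ g (hole M)))) (vtx (vert n 0ℤ)) (φ g (hole M)) (φ g x))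
            (trans eq (cong (q *_) n≡)))))
      where
      e : ∀ j i h x → h - x ≡ j - i - x + (i - 0ℤ) + - (j - h)
      e = solve-∀
    ... | c , y≡ = ℕ.≤-trans (drop‿+≤+ (begin
        + k                              ≡⟨ k≡ ⟩
        + 7 + M * + 15                   ≤⟨ hole-deep M 0≤M c ⟩
        + norm (hole M ⊖ᵥ lattice s c)   ≡⟨ cong (λ v → + norm (hole M ⊖ᵥ v)) (sym y≡) ⟩
        + norm (hole M ⊖ᵥ (hole M ⊖ᵥ x)) ≡⟨ cong +_ (norm-⊖ᵥ-⊖ᵥ (hole M) x) ⟩
        + norm x                         ∎)) (ℕ.≤-trans norm≤l l≤d)

    hasDiameter : HasDiameter n g k
    hasDiameter = diameter-≤ , vert n 0ℤ , vert n (φ g (hole M)) , hole-distance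

-- Exact divisions and conclusion

exact-/ℕ : ∀ {i q} d .{{_ : ℕ.NonZero d}} → 0ℤ ≤ q → i ≡ q * + d → i /ℕ d ≡ q
exact-/ℕ {q = + q} d _ refl = trans (cong (_/ℕ d) (sym (pos-* q d))) (cong +_ (ℕ.m*n/n≡m q d))

exact-∣ : ∀ {i} q d → i ≡ q * + d → + d ∣ i
exact-∣ q d eq = ∣⇒∣ᵤ (divides q eq)

theorem6 : (k : ℕ) → 0 < k → k % 15 ≡ 7 →
    ((+ 3125) ∣ numN k) × ((+ 625) ∣ num2 k) × ((+ 9375) ∣ num3 k)
    × ((+ 9375) ∣ num4 k) × ((+ 9375) ∣ num5 k)
    × HasDiameter (LCC10 k) (gens k) k
theorem6 k _ k%15≡7 =
  exact-∣ (polyℕ N M) 3125 (numN≡ k M k≡) , exact-∣ (polyℕ G₂ M) 625 (num2≡ k M k≡) ,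
  exact-∣ (polyℕ G₃ M) 9375 (num3≡ k M k≡) , exact-∣ (polyℕ G₄ M) 9375 (num4≡ k M k≡) ,
  exact-∣ (polyℕ G₅ M) 9375 (num5≡ k M k≡) ,
  hasDiameter m k (LCC10 k) (gens k) k≡ n≡ g≡ {{n≢0}}
  where
  m = k ℕ./ 15
  M = + m

  k≡ : + k ≡ + 7 + M * + 15
  k≡ = trans (cong +_ (trans (ℕ.m≡m%n+[m/n]*n k 15) (cong (ℕ._+ m ℕ.* 15) k%15≡7))) (cong (_+_ (+ 7)) (pos-* m 15))

  n≡ : + LCC10 k ≡ polyℕ N M
  n≡ = trans (cong +_ (trans (cong (ℕ._/ 3125) (trans (cong ∣_∣ (numN≡ k M k≡)) (abs-* (polyℕ N M) (+ 3125))))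
    (ℕ.m*n/n≡m ∣ polyℕ N M ∣ 3125))) (0≤i⇒+∣i∣≡i (poly-nonNeg N m))

  g≡ : ∀ t → gens k t ≡ γ M t
  g≡ Fin.zero                                        = refl
  g≡ (Fin.suc Fin.zero)                              = exact-/ℕ 625 (poly-nonNeg G₂ m) (num2≡ k M k≡)
  g≡ (Fin.suc (Fin.suc Fin.zero))                    = exact-/ℕ 9375 (poly-nonNeg G₃ m) (num3≡ k M k≡)
  g≡ (Fin.suc (Fin.suc (Fin.suc Fin.zero)))          = exact-/ℕ 9375 (poly-nonNeg G₄ m) (num4≡ k M k≡)
  g≡ (Fin.suc (Fin.suc (Fin.suc (Fin.suc Fin.zero)))) = exact-/ℕ 9375 (poly-nonNeg G₅ m) (num5≡ k M k≡)

  n≢0 : ℕ.NonZero (LCC10 k)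
  -- The coefficients of `N` are natural numbers, so n is at least its constant term 4551.
  n≢0 = ℕ.>-nonZero (drop‿+<+ (subst (0ℤ ℤ.<_) (sym n≡) (<-≤-trans (+<+ (ℕ.s≤s ℕ.z≤n))
    (+-monoʳ-≤ (+ 4551) (subst (_≤ M * r) (*-zeroʳ M) (*-monoˡ-≤-nonNeg M (poly-nonNeg (List.drop 1 N) m)))))))
    where r = polyℕ (List.drop 1 N) M
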